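{- Let $A\in\mathbb{R}_{\max}^{p\times n}$, $\mathbf{c}\in\mathbb{R}_{\max}^p$, $B\in\mathbb{G}^{p\times n}$, $\mathbf{d}\in\mathbb{G}^p$ be such that for all $i\in\{1,\dots,p\}$ and $j\in\{1,\dots,n\}$ either $A_{ij}=-\infty$ or $B_{ij}=-\infty$. Let $\mathcal{P}\subset\mathbb{G}^n$ be the set of $\mathbf{x}\in\mathbb{G}^n$ with $A\mathbf{x}\oplus\mathbf{c}\leq_{\mathbb{G}}B\mathbf{x}\oplus\mathbf{d}$. Let $\mathcal{Q}\subset\mathbb{G}^{n-1}$ be the set of $(\mathbf{x}_1,\dots,\mathbf{x}_{n-1})\in\mathbb{G}^{n-1}$ satisfying $$\Big(\bigoplus_{j\neq n}A_{ij}\mathbf{x}_j\Big)\oplus\mathbf{c}_i\leq_{\mathbb{G}}\Big(\bigoplus_{j\neq n}B_{ij}\mathbf{x}_j\Big)\oplus\mathbf{d}_i$$ for all $i$ such that $B_{in}=-\infty$, and $$\Big(\bigoplus_{j\neq n}A_{ij}\mathbf{x}_j\Big)\oplus\mathbf{c}_i\leq_{\mathbb{G}}\Big(\bigoplus_{j\neq n}(B_{ij}\oplus B_{in}A_{kn}^{ -1}B_{kj})\mathbf{x}_j\Big)\oplus\mathbf{d}_i\oplus B_{in}A_{kn}^{ -1}\mathbf{d}_k$$ for all $i,k$ such that $B_{in}\neq-\infty$ and $A_{kn}\neq-\infty$. Then, for all $\mathbf{x}\in\mathbb{R}_{\max}^{n-1}$, $\mathbf{x}\in\mathcal{Q}$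 if, and only if, there exists $\lambda\in\mathbb{R}_{\max}$ such that $(\mathbf{x},\lambda)\in\mathcal{P}$.
   Context: $\mathbb{R}_{\max}=\mathbb{R}\cup\{ -\infty\}$ is the max-plus semiring ($x\oplus y=\max(x,y)$, $x\otimes y=xy=x+y$), and $\overline{\mathbb{R}}_{\max}=\mathbb{R}_{\max}\cup\{+\infty\}$. Let $\mathbb{R}^-=\{\alpha^-:\alpha\in\mathbb{R}\}$ be a disjoint copy of $\mathbb{R}$ and $\mathbb{G}=\overline{\mathbb{R}}_{\max}\cup\mathbb{R}^-$. The modulus is $|x|=x$ for $x\in\overline{\mathbb{R}}_{\max}$ and $|\alpha^-|=\alpha$. The total order $\leq_{\mathbb{G}}$ is: $x\leq_{\mathbb{G}}y$ iff $|x|<|y|$ when $x\in\overline{\mathbb{R}}_{\max}$ and $y\in\mathbb{R}^-$, and $|x|\le|y|$ in all other cases. $\mathbb{G}$ is a semiring where $x\oplus y$ is the greater of $x,y$ for $\leq_{\mathbb{G}}$, and $xy$ is: $x+y$ if $x,y\in\mathbb{R}$; $(|x|+|y|)^-$ if $x\in\mathbb{R}^-$ or $y\in\mathbb{R}^-$ and both are different from $\pm\infty$; $-\infty$ if $x=-\infty$ or $y=-\infty$; $+\infty$ if neither is $-\infty$ and at least one is $+\infty$. The zero is $-\infty$, the unit is $0$; for $a\in\mathbb{R}$, $a^{ -1}=-a$. Matrix-vector operations use $\oplus$ and the product of $\mathbb{G}$; vector inequalities are entrywise. -}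

module Defs where

open import Algebra.Structures using (IsCommutativeRing)
open import Data.Bool.Base using (if_then_else_)
open import Data.Fin.Base using (fromℕ)
open import Data.Nat.Base using (ℕ; suc)
open import Data.Product.Base using (∃; _×_)
open import Data.Vec.Functional using (Vector; foldr; init; insertAt; last; map; zipWith)
open import Level using (Level)
import Level as L
open import Relation.Binary.Construct.Add.Extrema.NonStrict as NonStrict± using ()
open import Relation.Binary.Construct.Add.Extrema.Strict as Strict± using ()
open import Relation.Binary.Construct.NonStrictToStrict as ToStrict using ()
open import Relation.Binary.Core using (Rel)
open import Relation.Binary.Definitions using (Decidable)
open import Relation.Binary.PropositionalEquality.Core using (_≡_; _≢_; refl)
open import Relation.Binary.Structures using (IsDecTotalOrder)
open import Relation.Nullary.Construct.Add.Extrema using (_±; ⊥±; [_]; ⊤±)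
open import Relation.Nullary.Construct.Add.Infimum as Infimum using (_₋; ⊥₋)
open import Relation.Nullary.Construct.Add.Supremum as Supremum using ()
open import Relation.Nullary.Decidable.Core using (does)
open import Relation.Nullary.Negation.Core using (¬_; contradiction)
open import Relation.Unary using (Pred; _∈_)

-- The standard library has no type of real numbers.  ℝ is taken to be an
-- arbitrary model of its second-order axioms, which classically determine it
-- up to unique isomorphism.  The order is decidable, as it is classically:
-- without this the maximum on 𝔾 below could not be defined by comparison.
record RealNumbers (ℓ : Level) : Set (L.suc ℓ) where
  infixl 7 _*_
  infixl 6 _+_
  infix  8 -_
  infix  4 _≈_ _≤_ _<_
  field
    ℝ                 : Set ℓ
    _≈_ _≤_           : Rel ℝ ℓ
    _+_ _*_           : ℝ → ℝ → ℝ
    -_                : ℝ → ℝ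
    0# 1#             : ℝ
    isCommutativeRing : IsCommutativeRing _≈_ _+_ _*_ -_ 0# 1#
    0≉1               : ¬ (0# ≈ 1#)
    *-inverse         : ∀ x → ¬ (x ≈ 0#) → ∃ λ y → x * y ≈ 1#
    isDecTotalOrder   : IsDecTotalOrder _≈_ _≤_
    +-monoˡ-≤         : ∀ {x y} z → x ≤ y → x + z ≤ y + z
    *-nonNeg          : ∀ {x y} → 0# ≤ x → 0# ≤ y → 0# ≤ x * y

  UpperBound : Pred ℝ ℓ → Pred ℝ ℓ
  UpperBound S u = ∀ {x} → x ∈ S → x ≤ u

  field
    complete : (S : Pred ℝ ℓ) → ∃ S → ∃ (UpperBound S) →
               ∃ λ s → UpperBound S s × (∀ {u} → UpperBound S u → s ≤ u)

  _<_ : Rel ℝ ℓ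
  _<_ = ToStrict._<_ _≈_ _≤_

module MaxPlus {ℓ : Level} (reals : RealNumbers ℓ) where

  open RealNumbers reals public using (ℝ)
  open RealNumbers reals using (_≈_; _≤_; _<_; _+_; -_; isDecTotalOrder)
  open IsDecTotalOrder isDecTotalOrder using (_≟_; _≤?_)
  open NonStrict± _≤_ using (_≤±_; ≤±-dec)
  open Strict± _<_ using (_<±_; <±-dec)

  infix  4 _≤𝔾_ _≤𝔾?_
  infixl 6 _⊕_
  infixl 7 _⊗_
  infix  9 _⁻

  ℝmax : Set ℓ
  ℝmax = ℝ ₋

  ℝ̄max : Set ℓ
  ℝ̄max = ℝ ±

  data 𝔾 : Set ℓ where
    num : ℝ̄max → 𝔾
    _⁻  : ℝ → 𝔾

  pattern -∞    = num ⊥±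
  pattern +∞    = num ⊤±
  pattern fin α = num [ α ]

  ι : ℝmax → 𝔾
  ι x = num Supremum.[ x ]

  ∣_∣ : 𝔾 → ℝ̄max
  ∣ num x ∣ = x
  ∣ α ⁻ ∣   = [ α ]

  _≤𝔾_ : Rel 𝔾 ℓ
  x@(num _) ≤𝔾 y@(_ ⁻)   = ∣ x ∣ <± ∣ y ∣
  x@(num _) ≤𝔾 y@(num _) = ∣ x ∣ ≤± ∣ y ∣
  x@(_ ⁻)   ≤𝔾 y         = ∣ x ∣ ≤± ∣ y ∣

  _≤𝔾?_ : Decidable _≤𝔾_
  x@(num _) ≤𝔾? y@(_ ⁻)   = <±-dec (ToStrict.<-decidable _≈_ _≤_ _≟_ _≤?_) ∣ x ∣ ∣ y ∣
  x@(num _) ≤𝔾? y@(num _) = ≤±-dec _≤?_ ∣ x ∣ ∣ y ∣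
  x@(_ ⁻)   ≤𝔾? y         = ≤±-dec _≤?_ ∣ x ∣ ∣ y ∣

  _⊕_ : 𝔾 → 𝔾 → 𝔾
  x ⊕ y = if does (x ≤𝔾? y) then y else x

  _⊗_ : 𝔾 → 𝔾 → 𝔾
  -∞      ⊗ _       = -∞
  +∞      ⊗ -∞      = -∞
  +∞      ⊗ (num _) = +∞
  +∞      ⊗ (_ ⁻)   = +∞
  (fin _) ⊗ -∞      = -∞
  (fin _) ⊗ +∞      = +∞
  (fin α) ⊗ (fin β) = fin (α + β)
  (fin α) ⊗ (β ⁻)   = (α + β) ⁻
  (_ ⁻)   ⊗ -∞      = -∞
  (_ ⁻)   ⊗ +∞      = +∞
  (α ⁻)   ⊗ (fin β) = (α + β) ⁻
  (α ⁻)   ⊗ (β ⁻)   = (α + β) ⁻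

  -- The inverse for ⊗ of an element of ℝmax other than -∞, i.e. of a real.
  inv : (a : ℝmax) → a ≢ ⊥₋ → ℝmax
  inv ⊥₋            a≢-∞ = contradiction refl a≢-∞
  inv Infimum.[ α ] _    = Infimum.[ - α ]

  Matrix : Set ℓ → ℕ → ℕ → Set ℓ
  Matrix X p n = Vector (Vector X n) p

  ⨁ : ∀ {n} → Vector 𝔾 n → 𝔾
  ⨁ = foldr _⊕_ -∞

  infix 8 _·_

  _·_ : ∀ {n} → Vector 𝔾 n → Vector 𝔾 n → 𝔾
  u · v = ⨁ (zipWith _⊗_ u v)

  snoc : ∀ {a} {X : Set a} {m} → Vector X m → X → Vector X (suc m)
  snoc {m = m} x y = insertAt x (fromℕ m) y

  𝒫 : ∀ {p n} → Matrix ℝmax p n → Vector ℝmax p →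
      Matrix 𝔾 p n → Vector 𝔾 p → Pred (Vector 𝔾 n) ℓ
  𝒫 A c B d x = ∀ i → map ι (A i) · x ⊕ ι (c i) ≤𝔾 B i · x ⊕ d i

  𝒬 : ∀ {p m} → Matrix ℝmax p (suc m) → Vector ℝmax p →
      Matrix 𝔾 p (suc m) → Vector 𝔾 p → Pred (Vector 𝔾 m) ℓ
  𝒬 A c B d x =
    (∀ i → last (B i) ≡ -∞ →
       map ι (init (A i)) · x ⊕ ι (c i) ≤𝔾 init (B i) · x ⊕ d i)
    ×
    (∀ i k → last (B i) ≢ -∞ → (Aₖₙ≢-∞ : last (A k) ≢ ⊥₋) →
       let r = last (B i) ⊗ ι (inv (last (A k)) Aₖₙ≢-∞) in
       map ι (init (A i)) · x ⊕ ι (c i)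
         ≤𝔾 (λ j → init (B i) j ⊕ r ⊗ init (B k) j) · x ⊕ d i ⊕ r ⊗ d k)

{-# OPTIONS --safe #-}
module Submission where

-- Since A i n or B i n is -∞, row i holds at (x , μ) iff an upper bound on μ
-- (from A i n) and a lower bound on μ (from B i n) both hold.  The system 𝒬
-- makes each lower bound compatible with each upper bound.  Upper bounds cut
-- out down-closed and lower bounds up-closed subsets of ℝmax, so the
-- one-dimensional Helly property, applied once for ≤ and once for ≥, turns
-- pairwise compatibility into a common solution μ.  When the upper bound is a
-- signed α⁻, the unsigned μ must be strictly below α; room for it is left by
-- the strictness of the comparison of unsigned elements with signed ones.

open import Defs
open import Algebra.Bundles using (AbelianGroup; CommutativeSemiring)
open import Algebra.Construct.NaturalChoice.Base using (MaxOperator)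
import Algebra.Construct.NaturalChoice.MaxOp as MaxOp
import Algebra.Properties.CommutativeSemigroup as CommutativeSemigroupProperties
import Algebra.Properties.Group as GroupProperties
import Algebra.Properties.Semiring.Sum as SemiringSum
open import Algebra.Structures using (IsCommutativeRing)
open import Algebra.Structures.Biased using (isCommutativeSemiringˡ)
open import Data.Fin.Base using (Fin; zero; suc; fromℕ; inject₁)
open import Data.Nat.Base using (ℕ; zero; suc)
open import Data.Product.Base using (∃; _×_; _,_; proj₁; proj₂)
open import Data.Sum.Base using (_⊎_; inj₁; inj₂; [_,_]′)
open import Data.Vec.Functional using (Vector; map; init; last; zipWith)
open import Data.Vec.Functional.Properties using (insertAt-lookup)
open import Function.Base using (_∘_; flip)
open import Function.Bundles using (_⇔_; mk⇔)
open import Relation.Binary.Bundles using (Poset; TotalPreorder)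
open import Relation.Binary.Core using (Rel)
open import Relation.Binary.Definitions 
  using (Minimum; Maximum; Reflexive; Total; Transitive)
import Relation.Binary.Construct.Add.Extrema.NonStrict as NonStrict±
import Relation.Binary.Construct.Add.Extrema.Strict as Strict±
import Relation.Binary.Construct.Add.Supremum.NonStrict as Supremum
open import Relation.Binary.Construct.Interior.Symmetric as Interior using (lhs≤rhs)
import Relation.Binary.Construct.NonStrictToStrict as ToStrict
open import Relation.Binary.PropositionalEquality.Core as ≡ using (_≡_; _≢_; refl)
import Relation.Binary.Reasoning.PartialOrder as PosetReasoning
import Relation.Binary.Reasoning.Preorder as PreorderReasoning
import Relation.Binary.Reasoning.Setoid as SetoidReasoning
open import Relation.Binary.Structures using (IsDecTotalOrder)
open import Relation.Nullary.Construct.Add.Extrema using (⊥±; [_]; ⊤±)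
open import Relation.Nullary.Construct.Add.Infimum as Infimum using (⊥₋)
open import Relation.Nullary.Decidable.Core using (yes; no)
open import Relation.Nullary.Negation.Core using (¬_; contradiction)
open import Relation.Unary using (Pred; _∈_)

-- Ordered-field facts about ℝ: translation, density, unboundedness.

module RealProperties {ℓ} (reals : RealNumbers ℓ) where

  open RealNumbers reals
  open IsCommutativeRing isCommutativeRing public
    using (+-isAbelianGroup; +-assoc; +-comm; +-cong; +-identityˡ; +-identityʳ; -‿inverseˡ;
           *-congˡ; *-identityˡ; *-identityʳ; distribˡ; distribʳ)
  open IsDecTotalOrder isDecTotalOrder public
    using (_≤?_; module Eq; isPartialOrder; antisym; total; ≤-respˡ-≈; ≤-respʳ-≈)
    renaming (refl to ≤-refl; reflexive to ≤-reflexive; trans to ≤-trans)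

  ≤-poset : Poset ℓ ℓ ℓ
  ≤-poset = record { isPartialOrder = isPartialOrder }

  +-abelianGroup : AbelianGroup ℓ ℓ
  +-abelianGroup = record { isAbelianGroup = +-isAbelianGroup }

  open GroupProperties (AbelianGroup.group +-abelianGroup)
    using (∙-cancelˡ; \\-leftDividesˡ; \\-leftDividesʳ)
  open ToStrict _≈_ _≤_ public using (<⇒≤)
  open PosetReasoning ≤-poset

  <⇒≱ : ∀ {x y} → x < y → ¬ (y ≤ x)
  <⇒≱ = ToStrict.<⇒≱ _≈_ _≤_ antisym

  ≰⇒> : ∀ {x y} → ¬ (x ≤ y) → y < x
  ≰⇒> = ToStrict.≰⇒> _≈_ _≤_ Eq.sym ≤-reflexive total

  +-monoʳ-≤ : ∀ x {y z} → y ≤ z → x + y ≤ x + z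
  +-monoʳ-≤ x {y} {z} y≤z = begin
    x + y ≈⟨ +-comm x y ⟩
    y + x ≤⟨ +-monoˡ-≤ x y≤z ⟩
    z + x ≈⟨ +-comm z x ⟩
    x + z ∎

  +-mono-≤ : ∀ {x y u v} → x ≤ y → u ≤ v → x + u ≤ y + v
  +-mono-≤ {y = y} {u} x≤y u≤v = ≤-trans (+-monoˡ-≤ u x≤y) (+-monoʳ-≤ y u≤v)

  +-monoʳ-< : ∀ x {y z} → y < z → x + y < x + z
  +-monoʳ-< x (y≤z , y≉z) = +-monoʳ-≤ x y≤z , y≉z ∘ ∙-cancelˡ x _ _

  x+y<z⇒y<-x+z : ∀ {x y z} → x + y < z → y < - x + z
  x+y<z⇒y<-x+z {x} {y} {z} lt = begin-strict
    y             ≈⟨ \\-leftDividesʳ x y ⟨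
    - x + (x + y) <⟨ +-monoʳ-< (- x) lt ⟩
    - x + z       ∎

  x<y+z⇒-y+x<z : ∀ {x y z} → x < y + z → - y + x < z
  x<y+z⇒-y+x<z {x} {y} {z} lt = begin-strict
    - y + x       <⟨ +-monoʳ-< (- y) lt ⟩
    - y + (y + z) ≈⟨ \\-leftDividesʳ y z ⟩
    z             ∎

  -x+y<z⇒y<x+z : ∀ {x y z} → - x + y < z → y < x + z
  -x+y<z⇒y<x+z {x} {y} {z} lt = begin-strict
    y             ≈⟨ \\-leftDividesˡ x y ⟨
    x + (- x + y) <⟨ +-monoʳ-< x lt ⟩
    x + z         ∎

  -- Whichever sign 1 has, adding 1 to its comparison with 0 gives, if 1 + 1 vanished, the reverse
  -- comparison, so 0 and 1 would coincide. Halves, and hence midpoints, rest on this.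
  1+1≉0 : ¬ (1# + 1# ≈ 0#)
  1+1≉0 1+1≈0 with total 0# 1#
  ... | inj₁ 0≤1 = 0≉1 (antisym 0≤1 (begin
    1#      ≈⟨ +-identityˡ 1# ⟨
    0# + 1# ≤⟨ +-monoˡ-≤ 1# 0≤1 ⟩
    1# + 1# ≈⟨ 1+1≈0 ⟩
    0#      ∎))
  ... | inj₂ 1≤0 = 0≉1 (antisym (begin
    0#      ≈⟨ 1+1≈0 ⟨
    1# + 1# ≤⟨ +-monoˡ-≤ 1# 1≤0 ⟩
    0# + 1# ≈⟨ +-identityˡ 1# ⟩
    1#      ∎) 1≤0)

  ∃-half : ∀ x → ∃ λ y → y + y ≈ x
  ∃-half x with *-inverse (1# + 1#) 1+1≉0
  ... | h , 2h≈1 = x * h , (begin-equality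
    x * h + x * h         ≈⟨ distribˡ x h h ⟨
    x * (h + h)           ≈⟨ *-congˡ (+-cong (*-identityˡ h) (*-identityˡ h)) ⟨
    x * (1# * h + 1# * h) ≈⟨ *-congˡ (distribʳ h 1# 1#) ⟨
    x * ((1# + 1#) * h)   ≈⟨ *-congˡ 2h≈1 ⟩
    x * 1#                ≈⟨ *-identityʳ x ⟩
    x                     ∎)

  <-dense : ∀ {x y} → x < y → ∃ λ z → x < z × z < y
  <-dense {x} {y} x<y with ∃-half (x + y)
  ... | z , 2z≈x+y = z , ≰⇒> z≰x , ≰⇒> y≰z
    where
    z≰x : ¬ (z ≤ x)
    z≰x z≤x = <⇒≱ (+-monoʳ-< x x<y) (begin
      x + y ≈⟨ 2z≈x+y ⟨
      z + z ≤⟨ +-mono-≤ z≤x z≤x ⟩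
      x + x ∎)

    y≰z : ¬ (y ≤ z)
    y≰z y≤z = <⇒≱ (+-monoʳ-< y x<y) (begin
      y + y ≤⟨ +-mono-≤ y≤z y≤z ⟩
      z + z ≈⟨ 2z≈x+y ⟩
      x + y ≈⟨ +-comm x y ⟩
      y + x ∎)

  ∃-positive : ∃ λ x → 0# < x
  ∃-positive with total 0# 1#
  ... | inj₁ 0≤1 = 1# , 0≤1 , 0≉1
  -- If 1 were at most 0, its negative would be positive; the summand `0#` only fits the shape of
  -- `x+y<z⇒y<-x+z`.
  ... | inj₂ 1≤0 = - 1# + 0# , x+y<z⇒y<-x+z (begin-strict
    1# + 0# ≈⟨ +-identityʳ 1# ⟩
    1#      <⟨ 1≤0 , 0≉1 ∘ Eq.sym ⟩
    0#      ∎)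

  ∃-> : ∀ x → ∃ λ y → x < y
  ∃-> x with ∃-positive
  ... | e , 0<e = x + e , (begin-strict
    x      ≈⟨ +-identityʳ x ⟨
    x + 0# <⟨ +-monoʳ-< x 0<e ⟩
    x + e  ∎)

  ∃-< : ∀ x → ∃ λ y → y < x
  ∃-< x with ∃-> x
  -- The witness is the mirror image of `y` in `x`.
  ... | y , x<y = - y + (x + x) , x<y+z⇒-y+x<z (begin-strict
    x + x <⟨ +-monoʳ-< x x<y ⟩
    x + y ≈⟨ +-comm x y ⟩
    y + x ∎)

-- The total order of 𝔾 and its maximum.

module MaxPlusProperties {ℓ} (reals : RealNumbers ℓ) where

  open MaxPlus reals
  open RealNumbers reals using (_≈_; _≤_; _<_; _+_; -_; 0#)
  open RealProperties reals
  open NonStrict± _≤_ 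
    using (_≤±_; ≤±-trans; ≤±-total; ⊥±≤_; _≤⊤±; ⊥±≤⊥±; [_]≤⊤±; ⊤±≤⊤±)
  open Strict± _<_ using (_<±_; <±-transˡ; <±-transʳ; ⊥±<[_]; ⊥±<⊤±; [_]<⊤±)

  <±⇒≤± : ∀ {x y} → x <± y → x ≤± y
  <±⇒≤± ⊥±<[ _ ]     = ⊥±≤ _
  <±⇒≤± Strict±.[ p ] = NonStrict±.[ <⇒≤ p ]
  <±⇒≤± ⊥±<⊤±         = ⊥±≤ _
  <±⇒≤± [ _ ]<⊤±      = _ ≤⊤±

  ≤±-<±-trans : ∀ {x y z} → x ≤± y → y <± z → x <± z
  ≤±-<±-trans = <±-transʳ (ToStrict.≤-<-trans _≈_ _≤_ ≤-trans antisym ≤-respˡ-≈)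

  <±-≤±-trans : ∀ {x y z} → x <± y → y ≤± z → x <± z
  <±-≤±-trans = <±-transˡ (ToStrict.<-≤-trans _≈_ _≤_ Eq.sym ≤-trans antisym ≤-respʳ-≈)

  ≤𝔾-refl : Reflexive _≤𝔾_
  ≤𝔾-refl { -∞}    = ⊥±≤⊥±
  ≤𝔾-refl {fin α}  = NonStrict±.[ ≤-refl ]
  ≤𝔾-refl { +∞}    = ⊤±≤⊤±
  ≤𝔾-refl {α ⁻}    = NonStrict±.[ ≤-refl ]

  -- The element `α ⁻` sits just below `fin α` and above every `fin β` with β < α. Every passage
  -- from an unsigned to a signed element contributes a strict step, and one strict step makes the
  -- composite strict.
  ≤𝔾-trans : Transitive _≤𝔾_
  ≤𝔾-trans {num _} {num _} {num _} p q = ≤±-trans ≤-trans p q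
  ≤𝔾-trans {num _} {num _} {_ ⁻}   p q = ≤±-<±-trans p q
  ≤𝔾-trans {num _} {_ ⁻}   {num _} p q = <±⇒≤± (<±-≤±-trans p q)
  ≤𝔾-trans {num _} {_ ⁻}   {_ ⁻}   p q = <±-≤±-trans p q
  ≤𝔾-trans {_ ⁻}   {num _} {num _} p q = ≤±-trans ≤-trans p q
  ≤𝔾-trans {_ ⁻}   {num _} {_ ⁻}   p q = ≤±-trans ≤-trans p (<±⇒≤± q)
  ≤𝔾-trans {_ ⁻}   {_ ⁻}   {num _} p q = ≤±-trans ≤-trans p q
  ≤𝔾-trans {_ ⁻}   {_ ⁻}   {_ ⁻}   p q = ≤±-trans ≤-trans p q

  num-⁻-total : ∀ x α → num x ≤𝔾 α ⁻ ⊎ α ⁻ ≤𝔾 num x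
  num-⁻-total ⊥±    α = inj₁ ⊥±<[ α ]
  num-⁻-total ⊤±    α = inj₂ [ α ]≤⊤±
  num-⁻-total [ β ] α with α ≤? β
  ... | yes α≤β = inj₂ NonStrict±.[ α≤β ]
  ... | no  α≰β = inj₁ Strict±.[ ≰⇒> α≰β ]

  ≤𝔾-total : Total _≤𝔾_
  ≤𝔾-total (num x) (num y) = ≤±-total total x y
  ≤𝔾-total (num x) (α ⁻)   = num-⁻-total x α
  ≤𝔾-total (α ⁻)   (num x) = [ inj₂ , inj₁ ]′ (num-⁻-total x α)
  ≤𝔾-total (α ⁻)   (β ⁻)   = ≤±-total total [ α ] [ β ]

  -∞-minimum : Minimum _≤𝔾_ -∞
  -∞-minimum (num x) = ⊥±≤ x
  -∞-minimum (α ⁻)   = ⊥±<[ α ]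

  +∞-maximum : Maximum _≤𝔾_ +∞
  +∞-maximum (num x) = x ≤⊤±
  +∞-maximum (α ⁻)   = [ α ]≤⊤±

  -- Equality on 𝔾 is taken to be mutual `≤𝔾`: the laws of ℝ hold only up to `≈`, so those of 𝔾
  -- cannot be stated with `≡`.
  ≤𝔾-totalPreorder : TotalPreorder ℓ ℓ ℓ
  ≤𝔾-totalPreorder = record
    { isTotalPreorder = record
      { isPreorder = Interior.isPreorder ≤𝔾-refl ≤𝔾-trans
      ; total      = ≤𝔾-total
      }
    }

  open TotalPreorder ≤𝔾-totalPreorder public
    using () renaming (_≈_ to _≈𝔾_; module Eq to ≈𝔾; preorder to ≤𝔾-preorder)

  ⊕-maxOperator : MaxOperator ≤𝔾-totalPreorder
  ⊕-maxOperator = record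
    { _⊔_       = _⊕_
    ; x≤y⇒x⊔y≈y = x≤y⇒x⊕y≈y
    ; x≥y⇒x⊔y≈x = x≥y⇒x⊕y≈x
    }
    where
    x≤y⇒x⊕y≈y : ∀ {x y} → x ≤𝔾 y → x ⊕ y ≈𝔾 y
    x≤y⇒x⊕y≈y {x} {y} x≤y with x ≤𝔾? y
    ... | yes _   = ≈𝔾.refl
    ... | no  x≰y = contradiction x≤y x≰y

    x≥y⇒x⊕y≈x : ∀ {x y} → y ≤𝔾 x → x ⊕ y ≈𝔾 x
    x≥y⇒x⊕y≈x {x} {y} y≤x with x ≤𝔾? y
    -- In a tie `⊕` returns its right argument, which is equal to the left one only in the sense of
    -- `≈𝔾`.
    ... | yes x≤y = y≤x Interior., x≤y
    ... | no  _   = ≈𝔾.refl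

  open MaxOp ⊕-maxOperator public
    using () renaming
    ( x≤x⊔y to x≤x⊕y; x≤y⊔x to y≤x⊕y; ⊔-lub to ⊕-lub; ⊔-mono-≤ to ⊕-mono
    ; ⊔-isMonoid to ⊕-isMonoid; ⊔-comm to ⊕-comm; mono-≤-distrib-⊔ to mono-distrib-⊕
    )

  ≤⊕-split : ∀ {x} y z → x ≤𝔾 y ⊕ z → x ≤𝔾 y ⊎ x ≤𝔾 z
  ≤⊕-split y z h with y ≤𝔾? z
  ... | yes _ = inj₂ h
  ... | no  _ = inj₁ h

  ⊕-monoʳ : ∀ x {y z} → y ≤𝔾 z → x ⊕ y ≤𝔾 x ⊕ z
  ⊕-monoʳ x {y} {z} y≤z = ⊕-mono {x} {x} {z} {y} (≤𝔾-refl {x}) y≤z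

  -- The semiring laws of 𝔾.

  fin-cong : ∀ {α β} → α ≈ β → fin α ≈𝔾 fin β
  fin-cong α≈β = NonStrict±.[ ≤-reflexive α≈β ] Interior., NonStrict±.[ ≤-reflexive (Eq.sym α≈β) ]

  ⁻-cong : ∀ {α β} → α ≈ β → α ⁻ ≈𝔾 β ⁻
  ⁻-cong α≈β = NonStrict±.[ ≤-reflexive α≈β ] Interior., NonStrict±.[ ≤-reflexive (Eq.sym α≈β) ]

  ⊗-comm : ∀ x y → x ⊗ y ≈𝔾 y ⊗ x
  ⊗-comm -∞      -∞      = ≈𝔾.refl
  ⊗-comm -∞      +∞      = ≈𝔾.refl
  ⊗-comm -∞      (fin _) = ≈𝔾.refl
  ⊗-comm -∞      (_ ⁻)   = ≈𝔾.refl
  ⊗-comm +∞      -∞      = ≈𝔾.refl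
  ⊗-comm +∞      +∞      = ≈𝔾.refl
  ⊗-comm +∞      (fin _) = ≈𝔾.refl
  ⊗-comm +∞      (_ ⁻)   = ≈𝔾.refl
  ⊗-comm (fin _) -∞      = ≈𝔾.refl
  ⊗-comm (fin _) +∞      = ≈𝔾.refl
  ⊗-comm (fin α) (fin β) = fin-cong (+-comm α β)
  ⊗-comm (fin α) (β ⁻)   = ⁻-cong (+-comm α β)
  ⊗-comm (_ ⁻)   -∞      = ≈𝔾.refl
  ⊗-comm (_ ⁻)   +∞      = ≈𝔾.refl
  ⊗-comm (α ⁻)   (fin β) = ⁻-cong (+-comm α β)
  ⊗-comm (α ⁻)   (β ⁻)   = ⁻-cong (+-comm α β)

  ⊗-zeroʳ : ∀ x → x ⊗ -∞ ≡ -∞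
  ⊗-zeroʳ -∞      = refl
  ⊗-zeroʳ +∞      = refl
  ⊗-zeroʳ (fin _) = refl
  ⊗-zeroʳ (_ ⁻)   = refl

  ⊗-assoc : ∀ x y z → (x ⊗ y) ⊗ z ≈𝔾 x ⊗ (y ⊗ z)
  ⊗-assoc -∞      y       z       = ≈𝔾.refl
  ⊗-assoc x       -∞      z       rewrite ⊗-zeroʳ x = ≈𝔾.refl
  ⊗-assoc x       y       -∞
    rewrite ⊗-zeroʳ (x ⊗ y) | ⊗-zeroʳ y | ⊗-zeroʳ x = ≈𝔾.refl
  ⊗-assoc +∞      +∞      +∞      = ≈𝔾.refl
  ⊗-assoc +∞      +∞      (fin _) = ≈𝔾.refl
  ⊗-assoc +∞      +∞      (_ ⁻)   = ≈𝔾.refl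
  ⊗-assoc +∞      (fin _) +∞      = ≈𝔾.refl
  ⊗-assoc +∞      (fin _) (fin _) = ≈𝔾.refl
  ⊗-assoc +∞      (fin _) (_ ⁻)   = ≈𝔾.refl
  ⊗-assoc +∞      (_ ⁻)   +∞      = ≈𝔾.refl
  ⊗-assoc +∞      (_ ⁻)   (fin _) = ≈𝔾.refl
  ⊗-assoc +∞      (_ ⁻)   (_ ⁻)   = ≈𝔾.refl
  ⊗-assoc (fin _) +∞      +∞      = ≈𝔾.refl
  ⊗-assoc (fin _) +∞      (fin _) = ≈𝔾.refl
  ⊗-assoc (fin _) +∞      (_ ⁻)   = ≈𝔾.refl
  ⊗-assoc (fin _) (fin _) +∞      = ≈𝔾.refl
  ⊗-assoc (fin α) (fin β) (fin γ) = fin-cong (+-assoc α β γ)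
  ⊗-assoc (fin α) (fin β) (γ ⁻)   = ⁻-cong (+-assoc α β γ)
  ⊗-assoc (fin _) (_ ⁻)   +∞      = ≈𝔾.refl
  ⊗-assoc (fin α) (β ⁻)   (fin γ) = ⁻-cong (+-assoc α β γ)
  ⊗-assoc (fin α) (β ⁻)   (γ ⁻)   = ⁻-cong (+-assoc α β γ)
  ⊗-assoc (_ ⁻)   +∞      +∞      = ≈𝔾.refl
  ⊗-assoc (_ ⁻)   +∞      (fin _) = ≈𝔾.refl
  ⊗-assoc (_ ⁻)   +∞      (_ ⁻)   = ≈𝔾.refl
  ⊗-assoc (_ ⁻)   (fin _) +∞      = ≈𝔾.refl
  ⊗-assoc (α ⁻)   (fin β) (fin γ) = ⁻-cong (+-assoc α β γ)
  ⊗-assoc (α ⁻)   (fin β) (γ ⁻)   = ⁻-cong (+-assoc α β γ)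
  ⊗-assoc (_ ⁻)   (_ ⁻)   +∞      = ≈𝔾.refl
  ⊗-assoc (α ⁻)   (β ⁻)   (fin γ) = ⁻-cong (+-assoc α β γ)
  ⊗-assoc (α ⁻)   (β ⁻)   (γ ⁻)   = ⁻-cong (+-assoc α β γ)

  ⊗-identityˡ : ∀ x → fin 0# ⊗ x ≈𝔾 x
  ⊗-identityˡ -∞      = ≈𝔾.refl
  ⊗-identityˡ +∞      = ≈𝔾.refl
  ⊗-identityˡ (fin α) = fin-cong (+-identityˡ α)
  ⊗-identityˡ (α ⁻)   = ⁻-cong (+-identityˡ α)

  ⊗-monoʳ : ∀ z {x y} → x ≤𝔾 y → z ⊗ x ≤𝔾 z ⊗ y
  ⊗-monoʳ z {x} {y} = go z x y
    where
    go : ∀ z x y → x ≤𝔾 y → z ⊗ x ≤𝔾 z ⊗ y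
    go -∞      x       y       _ = -∞-minimum -∞
    go z       -∞      y       _ rewrite ⊗-zeroʳ z = -∞-minimum (z ⊗ y)
    go +∞      (fin _) -∞      Supremum.[ () ]
    go +∞      (_ ⁻)   -∞      Supremum.[ () ]
    go +∞      x       +∞      _ = +∞-maximum _
    go +∞      x       (fin _) _ = +∞-maximum _
    go +∞      x       (_ ⁻)   _ = +∞-maximum _
    go (fin _) x       +∞      _ = +∞-maximum _
    go (fin α) (fin _) (fin _) NonStrict±.[ p ] = NonStrict±.[ +-monoʳ-≤ α p ]
    go (fin α) (fin _) (_ ⁻)   Strict±.[ p ]    = Strict±.[ +-monoʳ-< α p ]
    go (fin α) (_ ⁻)   (fin _) NonStrict±.[ p ] = NonStrict±.[ +-monoʳ-≤ α p ]
    go (fin α) (_ ⁻)   (_ ⁻)   NonStrict±.[ p ] = NonStrict±.[ +-monoʳ-≤ α p ]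
    go (_ ⁻)   x       +∞      _ = +∞-maximum _
    go (α ⁻)   (fin _) (fin _) NonStrict±.[ p ] = NonStrict±.[ +-monoʳ-≤ α p ]
    -- A signed factor makes both products signed, so only the weak inequality remains to be shown.
    go (α ⁻)   (fin _) (_ ⁻)   Strict±.[ p ]    = NonStrict±.[ +-monoʳ-≤ α (<⇒≤ p) ]
    go (α ⁻)   (_ ⁻)   (fin _) NonStrict±.[ p ] = NonStrict±.[ +-monoʳ-≤ α p ]
    go (α ⁻)   (_ ⁻)   (_ ⁻)   NonStrict±.[ p ] = NonStrict±.[ +-monoʳ-≤ α p ]


  ⊗-monoˡ : ∀ z {x y} → x ≤𝔾 y → x ⊗ z ≤𝔾 y ⊗ z
  ⊗-monoˡ z {x} {y} x≤y = begin
    x ⊗ z ≈⟨ ⊗-comm x z ⟩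
    z ⊗ x ≲⟨ ⊗-monoʳ z x≤y ⟩
    z ⊗ y ≈⟨ ⊗-comm z y ⟩
    y ⊗ z ∎
    where open PreorderReasoning ≤𝔾-preorder

  ⊗-mono : ∀ {x y u v} → x ≤𝔾 y → u ≤𝔾 v → x ⊗ u ≤𝔾 y ⊗ v
  ⊗-mono {y = y} {u} x≤y u≤v = ≤𝔾-trans (⊗-monoˡ u x≤y) (⊗-monoʳ y u≤v)

  ⊗-cong : ∀ {x y u v} → x ≈𝔾 y → u ≈𝔾 v → x ⊗ u ≈𝔾 y ⊗ v
  ⊗-cong (x≤y Interior., y≤x) (u≤v Interior., v≤u) = ⊗-mono x≤y u≤v Interior., ⊗-mono y≤x v≤u

  𝔾-commutativeSemiring : CommutativeSemiring ℓ ℓ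
  𝔾-commutativeSemiring = record
    { isCommutativeSemiring = isCommutativeSemiringˡ (record
      { +-isCommutativeMonoid = record
        { isMonoid = ⊕-isMonoid -∞-minimum
        ; comm     = ⊕-comm
        }
      ; *-isCommutativeMonoid = record
        { isMonoid = record
          { isSemigroup = record
            { isMagma = record
              { isEquivalence = Interior.isEquivalence ≤𝔾-refl ≤𝔾-trans
              ; ∙-cong        = ⊗-cong
              }
            ; assoc = ⊗-assoc
            }
          ; identity = ⊗-identityˡ , λ x → ≈𝔾.trans (⊗-comm x _) (⊗-identityˡ x)
          }
        ; comm = ⊗-comm
        }
      -- Multiplication by `z` is monotone, and a monotone map commutes with the maximum of a total
      -- preorder.
      ; distribʳ = λ z → mono-distrib-⊕ (λ x≈y → ⊗-cong x≈y ≈𝔾.refl) (⊗-monoˡ z)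
      ; zeroˡ    = λ _ → ≈𝔾.refl
      })
    }

  open CommutativeSemiring 𝔾-commutativeSemiring public
    using (semiring) renaming
    ( setoid to ≈𝔾-setoid; +-commutativeSemigroup to ⊕-commutativeSemigroup
    ; +-cong to ⊕-cong; +-assoc to ⊕-assoc; +-identityʳ to ⊕-identityʳ
    ; distribˡ to ⊗-distribˡ-⊕; distribʳ to ⊗-distribʳ-⊕
    )
  open CommutativeSemigroupProperties ⊕-commutativeSemigroup public
    using () renaming (interchange to ⊕-interchange; xy∙z≈xz∙y to ⊕-swap)
  open SemiringSum semiring using (sum-cong-≋; sum-init-last; ∑-distrib-+; *-distribˡ-sum)

  ⊕-congˡ : ∀ x {y z} → y ≈𝔾 z → x ⊕ y ≈𝔾 x ⊕ z
  ⊕-congˡ x = ⊕-cong (≈𝔾.refl {x})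

  ⊕-congʳ : ∀ x {y z} → y ≈𝔾 z → y ⊕ x ≈𝔾 z ⊕ x
  ⊕-congʳ x y≈z = ⊕-cong y≈z (≈𝔾.refl {x})

  ⊗-congˡ : ∀ x {y z} → y ≈𝔾 z → x ⊗ y ≈𝔾 x ⊗ z
  ⊗-congˡ x = ⊗-cong (≈𝔾.refl {x})

  ⊗-congʳ : ∀ x {y z} → y ≈𝔾 z → y ⊗ x ≈𝔾 z ⊗ x
  ⊗-congʳ x y≈z = ⊗-cong y≈z (≈𝔾.refl {x})

  -- Linear forms and their last coordinate.

  ·-linear : ∀ {n} (u v x : Vector 𝔾 n) r →
             (λ j → u j ⊕ r ⊗ v j) · x ≈𝔾 u · x ⊕ r ⊗ (v · x)
  ·-linear u v x r = begin
    (λ j → u j ⊕ r ⊗ v j) · x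
      ≈⟨ sum-cong-≋ (λ j → ≈𝔾.trans (⊗-distribʳ-⊕ (x j) (u j) (r ⊗ v j))
                                     (⊕-congˡ (u j ⊗ x j) (⊗-assoc r (v j) (x j)))) ⟩
    ⨁ (λ j → u j ⊗ x j ⊕ r ⊗ (v j ⊗ x j))
      ≈⟨ ∑-distrib-+ (zipWith _⊗_ u x) (λ j → r ⊗ (v j ⊗ x j)) ⟩
    u · x ⊕ ⨁ (λ j → r ⊗ (v j ⊗ x j))
      ≈⟨ ⊕-congˡ (u · x) (*-distribˡ-sum r (zipWith _⊗_ v x)) ⟨
    u · x ⊕ r ⊗ (v · x) ∎
    where open SetoidReasoning ≈𝔾-setoid

  snoc-inject₁ : ∀ {a} {X : Set a} {n} (x : Vector X n) y j → snoc x y (inject₁ j) ≡ x j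
  snoc-inject₁ x y zero    = refl
  snoc-inject₁ x y (suc j) = snoc-inject₁ (x ∘ suc) y j

  ·-snoc : ∀ {n} (u : Vector 𝔾 (suc n)) (x : Vector ℝmax n) μ →
           u · map ι (snoc x μ) ≈𝔾 init u · map ι x ⊕ last u ⊗ ι μ
  ·-snoc {n} u x μ = begin
    u · map ι (snoc x μ)
      ≈⟨ sum-init-last (zipWith _⊗_ u (map ι (snoc x μ))) ⟩
    init u · init (map ι (snoc x μ)) ⊕ last u ⊗ ι (last (snoc x μ))
      ≈⟨ ⊕-cong
           (sum-cong-≋ (λ j → ≈𝔾.reflexive (≡.cong (λ y → init u j ⊗ ι y) (snoc-inject₁ x μ j))))
           (≈𝔾.reflexive (≡.cong (λ y → last u ⊗ ι y) (insertAt-lookup x (fromℕ n) μ))) ⟩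
    init u · map ι x ⊕ last u ⊗ ι μ ∎
    where open SetoidReasoning ≈𝔾-setoid

  -- Elements of 𝔾 that come from ℝmax, thus neither signed nor +∞.

  Unsigned : Pred 𝔾 ℓ
  Unsigned x = ∃ λ y → ι y ≡ x

  ⊕-unsigned : ∀ {x y} → Unsigned x → Unsigned y → Unsigned (x ⊕ y)
  ⊕-unsigned {x} {y} x∈ y∈ with x ≤𝔾? y
  ... | yes _ = y∈
  ... | no  _ = x∈

  ι-⊗-unsigned : ∀ x y → Unsigned (ι x ⊗ ι y)
  ι-⊗-unsigned ⊥₋            _             = ⊥₋ , refl
  ι-⊗-unsigned Infimum.[ _ ] ⊥₋            = ⊥₋ , refl
  ι-⊗-unsigned Infimum.[ α ] Infimum.[ β ] = Infimum.[ α + β ] , refl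

  -- Since A, c and x have entries in ℝmax, this keeps the left-hand sides of the system unsigned,
  -- as `∃-below` requires.
  ι-·-unsigned : ∀ {n} (u v : Vector ℝmax n) → Unsigned (map ι u · map ι v)
  ι-·-unsigned {zero}  u v = ⊥₋ , refl
  ι-·-unsigned {suc n} u v =
    ⊕-unsigned (ι-⊗-unsigned (u zero) (v zero)) (ι-·-unsigned (u ∘ suc) (v ∘ suc))

  -- Inverses, and solving for one unknown in ℝmax.

  inv-inverseˡ : ∀ a (a≢-∞ : a ≢ ⊥₋) → ι (inv a a≢-∞) ⊗ ι a ≈𝔾 fin 0#
  inv-inverseˡ ⊥₋            a≢-∞ = contradiction refl a≢-∞
  inv-inverseˡ Infimum.[ α ] _    = fin-cong (-‿inverseˡ α)

  inv-cancelˡ : ∀ a (a≢-∞ : a ≢ ⊥₋) x → ι (inv a a≢-∞) ⊗ (ι a ⊗ x) ≈𝔾 x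
  inv-cancelˡ a a≢-∞ x = begin
    ι (inv a a≢-∞) ⊗ (ι a ⊗ x) ≈⟨ ⊗-assoc (ι (inv a a≢-∞)) (ι a) x ⟨
    ι (inv a a≢-∞) ⊗ ι a ⊗ x   ≈⟨ ⊗-congʳ x (inv-inverseˡ a a≢-∞) ⟩
    fin 0# ⊗ x                 ≈⟨ ⊗-identityˡ x ⟩
    x                          ∎
    where open SetoidReasoning ≈𝔾-setoid

  inv-cancelʳ : ∀ a (a≢-∞ : a ≢ ⊥₋) x → ι a ⊗ (ι (inv a a≢-∞) ⊗ x) ≈𝔾 x
  inv-cancelʳ a a≢-∞ x = begin
    ι a ⊗ (ι (inv a a≢-∞) ⊗ x) ≈⟨ ⊗-assoc (ι a) (ι (inv a a≢-∞)) x ⟨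
    ι a ⊗ ι (inv a a≢-∞) ⊗ x   ≈⟨ ⊗-congʳ x (⊗-comm (ι a) (ι (inv a a≢-∞))) ⟩
    ι (inv a a≢-∞) ⊗ ι a ⊗ x   ≈⟨ ⊗-assoc (ι (inv a a≢-∞)) (ι a) x ⟩
    ι (inv a a≢-∞) ⊗ (ι a ⊗ x) ≈⟨ inv-cancelˡ a a≢-∞ x ⟩
    x                          ∎
    where open SetoidReasoning ≈𝔾-setoid

  -- Replaces a bound `u` in 𝔾 by a value in ℝmax. If `u` is +∞, a large real will do. If `u` is
  -- `α ⁻` and `b` is finite or signed, the product is signed while `p` is not, so the comparison is
  -- strict and leaves an open interval for μ. With `p` signed this fails: for `b` the unit and `p`
  -- and `u` both `α ⁻`, μ would have to satisfy α ≤ μ < α.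
  ∃-below : ∀ b u {p} → Unsigned p → p ≤𝔾 b ⊗ u → ∃ λ μ → ι μ ≤𝔾 u × p ≤𝔾 b ⊗ ι μ
  ∃-below b       u       (⊥₋ , refl)            _ = ⊥₋ , -∞-minimum u , -∞-minimum (b ⊗ -∞)
  ∃-below b       -∞      (Infimum.[ _ ] , refl) h = ⊥₋ , -∞-minimum -∞ , h
  ∃-below b       (fin α) (Infimum.[ _ ] , refl) h = Infimum.[ α ] , ≤𝔾-refl {fin α} , h
  ∃-below -∞      u       (Infimum.[ _ ] , refl) h = ⊥₋ , -∞-minimum u , h
  ∃-below +∞      +∞      (Infimum.[ π ] , refl) _ = Infimum.[ π ] , +∞-maximum (fin π) , +∞-maximum (fin π)
  ∃-below +∞      (α ⁻)   (Infimum.[ π ] , refl) _ with ∃-< α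
  ... | μ , μ<α = Infimum.[ μ ] , Strict±.[ μ<α ] , +∞-maximum (fin π)
  ∃-below (fin β) +∞      (Infimum.[ π ] , refl) _ with ∃-> (- β + π)
  ... | μ , lt = Infimum.[ μ ] , +∞-maximum (fin μ) , NonStrict±.[ <⇒≤ (-x+y<z⇒y<x+z lt) ]
  ∃-below (β ⁻)   +∞      (Infimum.[ π ] , refl) _ with ∃-> (- β + π)
  ... | μ , lt = Infimum.[ μ ] , +∞-maximum (fin μ) , Strict±.[ -x+y<z⇒y<x+z lt ]
  -- Here π < β + α, so there is room for μ strictly between π - β and α.
  ∃-below (fin β) (α ⁻)   (Infimum.[ π ] , refl) Strict±.[ h ] with <-dense (x<y+z⇒-y+x<z h)
  ... | μ , lt , μ<α = Infimum.[ μ ] , Strict±.[ μ<α ] , NonStrict±.[ <⇒≤ (-x+y<z⇒y<x+z lt) ]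
  ∃-below (β ⁻)   (α ⁻)   (Infimum.[ π ] , refl) Strict±.[ h ] with <-dense (x<y+z⇒-y+x<z h)
  ... | μ , lt , μ<α = Infimum.[ μ ] , Strict±.[ μ<α ] , Strict±.[ -x+y<z⇒y<x+z lt ]

  ∃-below-⊕ : ∀ b q u {p} → Unsigned p → p ≤𝔾 q ⊕ b ⊗ u → ∃ λ μ → ι μ ≤𝔾 u × p ≤𝔾 q ⊕ b ⊗ ι μ
  ∃-below-⊕ b q u {p} p∈ p≤ with ≤⊕-split q (b ⊗ u) p≤
  -- The constant term alone dominates `p`, so the least value -∞ serves.
  ... | inj₁ p≤q = ⊥₋ , -∞-minimum u , ≤𝔾-trans p≤q (x≤x⊕y q _)
  ... | inj₂ p≤bu with ∃-below b u p∈ p≤bu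
  ...   | μ , μ≤u , p≤bμ = μ , μ≤u , ≤𝔾-trans p≤bμ (y≤x⊕y q _)

  ⊗-+∞ : ∀ b → b ≡ -∞ ⊎ b ⊗ +∞ ≡ +∞
  ⊗-+∞ -∞      = inj₁ refl
  ⊗-+∞ +∞      = inj₂ refl
  ⊗-+∞ (fin _) = inj₂ refl
  ⊗-+∞ (_ ⁻)   = inj₂ refl

  ≡-∞-or-≢ : ∀ (b : 𝔾) → b ≡ -∞ ⊎ b ≢ -∞
  ≡-∞-or-≢ -∞      = inj₁ refl
  ≡-∞-or-≢ +∞      = inj₂ λ ()
  ≡-∞-or-≢ (fin _) = inj₂ λ ()
  ≡-∞-or-≢ (_ ⁻)   = inj₂ λ ()

  -- The case of `∃-below-⊕` with the vacuous bound +∞: unless `b` is -∞, the product `b ⊗ +∞` is +∞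
  -- and dominates everything.
  ∃-above : ∀ b q {p} → Unsigned p → (b ≡ -∞ → p ≤𝔾 q) → ∃ λ μ → p ≤𝔾 q ⊕ b ⊗ ι μ
  ∃-above b q {p} p∈ h with ∃-below-⊕ b q +∞ p∈ p≤
    where
    p≤ : p ≤𝔾 q ⊕ b ⊗ +∞
    p≤ with ⊗-+∞ b
    ... | inj₁ b≡-∞ = ≤𝔾-trans (h b≡-∞) (x≤x⊕y q _)
    ... | inj₂ b+∞≡+∞ rewrite b+∞≡+∞ = ≤𝔾-trans (+∞-maximum p) (y≤x⊕y q +∞)
  ... | μ , _ , p≤ = μ , p≤

  -- Compatibility of one lower with one upper bound. For finite `a` the upper bound says that μ is
  -- at most `a⁻¹ ⊗ q′`, and the last hypothesis says that this extreme value, possibly outside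
  -- ℝmax, satisfies the lower bound; `∃-below-⊕` then moves it into ℝmax.
  ∃-between : ∀ a b q q′ {p} → Unsigned p → (b ≡ -∞ → p ≤𝔾 q) →
              (b ≢ -∞ → (a≢-∞ : a ≢ ⊥₋) → p ≤𝔾 q ⊕ b ⊗ ι (inv a a≢-∞) ⊗ q′) →
              ∃ λ μ → p ≤𝔾 q ⊕ b ⊗ ι μ × ι a ⊗ ι μ ≤𝔾 q′
  ∃-between ⊥₋ b q q′ p∈ h _ with ∃-above b q p∈ h
  ... | μ , p≤ = μ , p≤ , -∞-minimum q′
  ∃-between a@(Infimum.[ _ ]) b q q′ {p} p∈ h k with ∃-below-⊕ b q (a⁻¹ ⊗ q′) p∈ p≤
    where
    a⁻¹ = ι (inv a λ ())

    p≤ : p ≤𝔾 q ⊕ b ⊗ (a⁻¹ ⊗ q′)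
    p≤ with ≡-∞-or-≢ b
    ... | inj₁ b≡-∞ = ≤𝔾-trans (h b≡-∞) (x≤x⊕y q _)
    ... | inj₂ b≢-∞ = ≤𝔾-trans (k b≢-∞ λ ()) (lhs≤rhs (⊕-congˡ q (⊗-assoc b a⁻¹ q′)))
  ... | μ , μ≤ , p≤ = μ , p≤ , ≤𝔾-trans (⊗-monoʳ (ι a) μ≤) (lhs≤rhs (inv-cancelʳ a (λ ()) q′))

  -- If `a` is -∞, the upper bound is trivial; if `b` is -∞, the right-hand side collapses to `q`,
  -- which then bounds the whole left-hand side.
  row-split : ∀ {a b p q} (x : 𝔾) → a ≡ ⊥₋ ⊎ b ≡ -∞ →
              p ⊕ ι a ⊗ x ≤𝔾 q ⊕ b ⊗ x → p ≤𝔾 q ⊕ b ⊗ x × ι a ⊗ x ≤𝔾 q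
  row-split {a} {b} {p} {q} x disj h = ≤𝔾-trans (x≤x⊕y p _) h , ax≤q disj
    where
    ax≤q : a ≡ ⊥₋ ⊎ b ≡ -∞ → ι a ⊗ x ≤𝔾 q
    ax≤q (inj₁ refl) = -∞-minimum q
    ax≤q (inj₂ refl) = ≤𝔾-trans (≤𝔾-trans (y≤x⊕y p (ι a ⊗ x)) h) (lhs≤rhs (⊕-identityʳ q))

  row-join : ∀ {a b p q} x → p ≤𝔾 q ⊕ b ⊗ x → ι a ⊗ x ≤𝔾 q → p ⊕ ι a ⊗ x ≤𝔾 q ⊕ b ⊗ x
  row-join {b = b} {q = q} x p≤ ax≤q = ⊕-lub p≤ (≤𝔾-trans ax≤q (x≤x⊕y q (b ⊗ x)))

-- One-dimensional Helly property, by induction on the number of sets: of a point in the first set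
-- and a point in all the others, the smaller lies in every set by down-closure. It is one of two
-- points of `K`, so it stays in `K`, whatever the shape of `K`.
∃-common : ∀ {a r k u} {X : Set a} {_≼_ : Rel X r} → Total _≼_ →
           ∀ {n} (K : Pred X k) (U : Fin n → Pred X u) →
           (∀ i {x y} → x ≼ y → U i y → U i x) →
           ∃ K → (∀ i → ∃ λ x → K x × U i x) →
           ∃ λ x → K x × ∀ i → U i x
∃-common total {zero}  K U down (x , x∈K) _ = x , x∈K , λ ()
∃-common total {suc n} K U down nonempty meet
  with meet zero | ∃-common total K (U ∘ suc) (down ∘ suc) nonempty (meet ∘ suc)
... | x , x∈K , x∈U₀ | y , y∈K , y∈U with total x y
...   | inj₁ x≼y = x , x∈K , λ { zero → x∈U₀ ; (suc i) → down (suc i) x≼y (y∈U i) }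
...   | inj₂ y≼x = y , y∈K , λ { zero → down zero y≼x x∈U₀ ; (suc i) → y∈U i }

-- Elimination of the last variable.

theorem11 : ∀ {ℓ} (reals : RealNumbers ℓ) → let open MaxPlus reals in
    ∀ {p m : ℕ}
    (A : Matrix ℝmax p (suc m)) (c : Vector ℝmax p)
    (B : Matrix 𝔾 p (suc m)) (d : Vector 𝔾 p) →
    (∀ i j → A i j ≡ ⊥₋ ⊎ B i j ≡ -∞) →
    (x : Vector ℝmax m) →
    (map ι x ∈ 𝒬 A c B d) ⇔ (∃ λ (μ : ℝmax) → map ι (snoc x μ) ∈ 𝒫 A c B d)
theorem11 reals {n} {m} A c B d disjoint x = mk⇔ extend project
  where
  open MaxPlus reals
  open MaxPlusProperties reals

  -- In this notation row i of 𝒫 at (x , μ) reads `p i ⊕ ι (a i) ⊗ ι μ ≤𝔾 q i ⊕ b i ⊗ ι μ`.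
  a : Vector ℝmax n
  a i = last (A i)

  b p q : Vector 𝔾 n
  b i = last (B i)
  p i = map ι (init (A i)) · map ι x ⊕ ι (c i)
  q i = init (B i) · map ι x ⊕ d i

  p-unsigned : ∀ i → Unsigned (p i)
  p-unsigned i = ⊕-unsigned (ι-·-unsigned (init (A i)) x) (c i , refl)

  row : ∀ (u : Vector 𝔾 (suc m)) v μ →
        u · map ι (snoc x μ) ⊕ v ≈𝔾 (init u · map ι x ⊕ v) ⊕ last u ⊗ ι μ
  row u v μ = ≈𝔾.trans (⊕-congʳ v (·-snoc u x μ))
                       (⊕-swap (init u · map ι x) (last u ⊗ ι μ) v)

  -- Brings the second family of 𝒬 to the form that `∃-between` expects: for r = `b i` times the
  -- inverse of `a k`, it is the lower bound of row i evaluated at the largest value that row k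
  -- allows.
  combined-row : ∀ i k r →
                 (λ j → init (B i) j ⊕ r ⊗ init (B k) j) · map ι x ⊕ d i ⊕ r ⊗ d k
                   ≈𝔾 q i ⊕ r ⊗ q k
  combined-row i k r = begin
    (λ j → init (B i) j ⊕ r ⊗ init (B k) j) · map ι x ⊕ d i ⊕ r ⊗ d k
      ≈⟨ ⊕-congʳ (r ⊗ d k) (⊕-congʳ (d i) (·-linear (init (B i)) (init (B k)) (map ι x) r)) ⟩
    Bᵢx ⊕ r ⊗ Bₖx ⊕ d i ⊕ r ⊗ d k
      ≈⟨ ⊕-assoc (Bᵢx ⊕ r ⊗ Bₖx) (d i) (r ⊗ d k) ⟩
    (Bᵢx ⊕ r ⊗ Bₖx) ⊕ (d i ⊕ r ⊗ d k)
      ≈⟨ ⊕-interchange Bᵢx (r ⊗ Bₖx) (d i) (r ⊗ d k) ⟩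
    q i ⊕ (r ⊗ Bₖx ⊕ r ⊗ d k)
      ≈⟨ ⊕-congˡ (q i) (⊗-distribˡ-⊕ r Bₖx (d k)) ⟨
    q i ⊕ r ⊗ q k ∎
    where
    open SetoidReasoning ≈𝔾-setoid
    Bᵢx = init (B i) · map ι x
    Bₖx = init (B k) · map ι x

  -- As sets of μ, `Lower i` is up-closed and `Upper k` is down-closed.
  Lower Upper : Fin n → Pred ℝmax _
  Lower i μ = p i ≤𝔾 q i ⊕ b i ⊗ ι μ
  Upper k μ = ι (a k) ⊗ ι μ ≤𝔾 q k

  extend : map ι x ∈ 𝒬 A c B d → ∃ λ μ → map ι (snoc x μ) ∈ 𝒫 A c B d
  extend (Q₁ , Q₂) = μ , λ i → begin
    map ι (A i) · map ι (snoc x μ) ⊕ ι (c i) ≈⟨ row (map ι (A i)) (ι (c i)) μ ⟩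
    p i ⊕ ι (a i) ⊗ ι μ                      ≲⟨ row-join (ι μ) (proj₂ (proj₂ common) i) (proj₁ (proj₂ common) i) ⟩
    q i ⊕ b i ⊗ ι μ                          ≈⟨ row (B i) (d i) μ ⟨
    B i · map ι (snoc x μ) ⊕ d i             ∎
    where
    open PreorderReasoning ≤𝔾-preorder

    total : Total (λ μ ν → ι μ ≤𝔾 ι ν)
    total μ ν = ≤𝔾-total (ι μ) (ι ν)

    lower-meets-upper : ∀ i → ∃ λ μ → Lower i μ × ∀ k → Upper k μ
    -- First use of Helly: one lower bound is kept fixed as `K` while all upper bounds are
    -- intersected.
    lower-meets-upper i = ∃-common total (Lower i) Upper
      (λ k μ≤ν → ≤𝔾-trans (⊗-monoʳ (ι (a k)) μ≤ν))
      (∃-above (b i) (q i) (p-unsigned i) (Q₁ i))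
      (λ k → ∃-between (a k) (b i) (q i) (q k) (p-unsigned i) (Q₁ i)
        λ bᵢ≢-∞ aₖ≢-∞ → ≤𝔾-trans (Q₂ i k bᵢ≢-∞ aₖ≢-∞) (lhs≤rhs (combined-row i k _)))

    common : ∃ λ μ → (∀ k → Upper k μ) × (∀ i → Lower i μ)
    -- Second use, for the reversed order, in which the lower bounds are down-closed; `K` is now the
    -- intersection of all upper bounds, and it contains -∞.
    common = ∃-common (flip total) (λ μ → ∀ k → Upper k μ) Lower
      (λ i ν≤μ h → ≤𝔾-trans h (⊕-monoʳ (q i) (⊗-monoʳ (b i) ν≤μ)))
      (⊥₋ , λ k → ≤𝔾-trans (lhs≤rhs (≈𝔾.reflexive (⊗-zeroʳ (ι (a k))))) (-∞-minimum (q k)))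
      (λ i → let μ , l , u = lower-meets-upper i in μ , u , l)

    μ = proj₁ common

  project : (∃ λ μ → map ι (snoc x μ) ∈ 𝒫 A c B d) → map ι x ∈ 𝒬 A c B d
  project (μ , P) = unbounded , combined
    where
    open PreorderReasoning ≤𝔾-preorder

    bounds : ∀ i → Lower i μ × Upper i μ
    bounds i = row-split (ι μ) (disjoint i (fromℕ m)) (begin
      p i ⊕ ι (a i) ⊗ ι μ                      ≈⟨ row (map ι (A i)) (ι (c i)) μ ⟨
      map ι (A i) · map ι (snoc x μ) ⊕ ι (c i) ≲⟨ P i ⟩
      B i · map ι (snoc x μ) ⊕ d i             ≈⟨ row (B i) (d i) μ ⟩
      q i ⊕ b i ⊗ ι μ                          ∎)

    unbounded : ∀ i → b i ≡ -∞ → p i ≤𝔾 q i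
    unbounded i bᵢ≡-∞ = begin
      p i             ≲⟨ proj₁ (bounds i) ⟩
      q i ⊕ b i ⊗ ι μ ≡⟨ ≡.cong (λ y → q i ⊕ y ⊗ ι μ) bᵢ≡-∞ ⟩
      q i ⊕ -∞        ≈⟨ ⊕-identityʳ (q i) ⟩
      q i             ∎

    -- Writing μ as the inverse of `a k` times `ι (a k) ⊗ ι μ` in the lower bound of row i lets the
    -- upper bound of row k replace that product by `q k`.
    combined : ∀ i k → b i ≢ -∞ → (aₖ≢-∞ : a k ≢ ⊥₋) →
               let r = b i ⊗ ι (inv (a k) aₖ≢-∞) in
               p i ≤𝔾 (λ j → init (B i) j ⊕ r ⊗ init (B k) j) · map ι x ⊕ d i ⊕ r ⊗ d k
    combined i k _ aₖ≢-∞ = begin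
      p i
        ≲⟨ proj₁ (bounds i) ⟩
      q i ⊕ b i ⊗ ι μ
        ≈⟨ ⊕-congˡ (q i) (⊗-congˡ (b i) (inv-cancelˡ (a k) aₖ≢-∞ (ι μ))) ⟨
      q i ⊕ b i ⊗ (a⁻¹ ⊗ (ι (a k) ⊗ ι μ))
        ≲⟨ ⊕-monoʳ (q i) (⊗-monoʳ (b i) (⊗-monoʳ a⁻¹ (proj₂ (bounds k)))) ⟩
      q i ⊕ b i ⊗ (a⁻¹ ⊗ q k)
        ≈⟨ ⊕-congˡ (q i) (⊗-assoc (b i) a⁻¹ (q k)) ⟨
      q i ⊕ b i ⊗ a⁻¹ ⊗ q k
        ≈⟨ combined-row i k (b i ⊗ a⁻¹) ⟨
      (λ j → init (B i) j ⊕ b i ⊗ a⁻¹ ⊗ init (B k) j) · map ι x ⊕ d i ⊕ b i ⊗ a⁻¹ ⊗ d k ∎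
      where a⁻¹ = ι (inv (a k) aₖ≢-∞)
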